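{- Let $(X,\mathcal{A})$ be a $(v,k,\lambda)$-BIBD with $k\ge 2$, and let $r=\lambda(v-1)/(k-1)$. If $(X,\mathcal{A})$ has a weak nesting $\phi:\mathcal{A}\to Y$ into a partial $(w,k+1,\lambda+1)$-BIBD, where $X\subseteq Y$ and $|Y|=w$, then \[ w\ \ge\ \frac{r}{\lambda+1}+\frac{v+2\lambda v+1}{2(\lambda+1)}. \]
   Context: A $(v,k,\lambda)$-BIBD is a pair $(X,\mathcal{A})$ where $X$ is a set of $v$ points and $\mathcal{A}$ is a multiset of $k$-subsets of $X$ (blocks) such that every pair of distinct points lies in exactly $\lambda$ blocks. A partial $(w,k,\lambda)$-BIBD is defined in the same way on $w$ points, except that every pair lies in at most $\lambda$ blocks. Given a $(v,k,\lambda)$-BIBD $(X,\mathcal{A})$ and a set $Y\supseteq X$ with $|Y|=w$, a map $\phi:\mathcal{A}\to Y$ is a weak nesting if $\phi(A)\notin A$ for every block $A$ and the multiset $\{A\cup\{\phi(A)\}:A\in\mathcal{A}\}$ is a partial $(w,k+1,\lambda+1)$-BIBD on $Y$. -}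

module Defs where

open import Data.Nat using (ℕ; suc; _≤_; _∸_; >-nonZero)
open import Data.Nat.Properties using (m<n⇒0<n∸m)
open import Data.Integer as ℤ using (+_; 1ℤ)
open import Data.Rational.Unnormalised using (ℚᵘ; _/_)
open import Data.Fin using (Fin)
open import Data.Fin.Subset using (Subset; _∈_; _∉_; _⊆_; _∪_; ⁅_⁆; ∣_∣)
open import Data.Fin.Subset.Properties using (_∈?_)
open import Data.Vec using (allFin; count)
open import Level using (0ℓ)
open import Relation.Binary.Core using (Rel)
open import Relation.Binary.PropositionalEquality using (_≡_; _≢_)
open import Relation.Nullary.Decidable using (_×-dec_)

-- Point sets are subsets of an ambient finite type Fin n.  A multiset of b
-- blocks is a family indexed by Fin b, so repeated blocks have different
-- indices and count separately.
Blocks : ℕ → ℕ → Set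
Blocks n b = Fin b → Subset n

pairCount : ∀ {n b} → Blocks n b → Fin n → Fin n → ℕ
pairCount {b = b} 𝒜 x y = count (λ i → (x ∈? 𝒜 i) ×-dec (y ∈? 𝒜 i)) (allFin b)

record IsDesign (_∼_ : Rel ℕ 0ℓ) (v k lam : ℕ) {n b : ℕ} (X : Subset n) (𝒜 : Blocks n b) : Set where
  field
    points    : ∣ X ∣ ≡ v
    block⊆    : ∀ i → 𝒜 i ⊆ X
    blockSize : ∀ i → ∣ 𝒜 i ∣ ≡ k
    pairs     : ∀ {x y} → x ∈ X → y ∈ X → x ≢ y → pairCount 𝒜 x y ∼ lam

IsBIBD : (v k lam : ℕ) {n b : ℕ} → Subset n → Blocks n b → Set
IsBIBD = IsDesign _≡_

IsPartialBIBD : (w k lam : ℕ) {n b : ℕ} → Subset n → Blocks n b → Set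
IsPartialBIBD = IsDesign _≤_

-- The map φ is defined on block indices, so two copies of the same block may
-- be sent to different points.
record IsWeakNesting (w k lam : ℕ) {n b : ℕ} (X Y : Subset n) (𝒜 : Blocks n b) (φ : Fin b → Fin n) : Set where
  field
    X⊆Y         : X ⊆ Y
    φ∈Y         : ∀ i → φ i ∈ Y
    φ∉block     : ∀ i → φ i ∉ 𝒜 i
    partialBIBD : IsPartialBIBD w (suc k) (suc lam) Y (λ i → 𝒜 i ∪ ⁅ φ i ⁆)

-- λ(v − 1)/(k − 1); the numerator is an integer subtraction, and the natural
-- subtraction k ∸ 1 is not truncated because k ≥ 2.
replication : (v k lam : ℕ) → .(2 ≤ k) → ℚᵘ
replication v k lam 2≤k = _/_ (+ lam ℤ.* (+ v ℤ.- 1ℤ)) (k ∸ 1) {{>-nonZero (m<n⇒0<n∸m 2≤k)}}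

{-# OPTIONS --safe #-}
-- For x ∈ X and y ∈ Y let e(x,y) be the number of blocks through x that φ sends
-- to y.  The sum of e over all x, y is bk.  A pair x ≠ y is covered by
-- c(x,y) + e(x,y) + e(y,x) augmented blocks, so that e(x,y) + e(y,x) is at most 1
-- when both points lie in X (where c = λ already) and at most λ + 1 when one lies
-- in X and the other in Y \ X.  Hence 2bk ≤ v(v − 1) + 2(λ + 1)v(w − v), while
-- counting pairs inside blocks gives bk(k − 1) = λv(v − 1).
module Submission where

open import Data.Nat using (ℕ; zero; suc; _+_; _*_; _≤_; z≤n; s≤s)
open import Data.Nat.Properties
open import Data.Nat.Tactic.RingSolver using (solve-∀)
open import Data.Integer using (+_)
import Data.Integer as ℤ
import Data.Integer.Properties as ℤₚ
open import Data.Rational.Unnormalised as ℚᵘ using (_/_; _÷_)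
open import Data.Bool using (true; false; if_then_else_)
open import Data.Fin using (Fin; zero; suc)
import Data.Fin as Fin
open import Data.Fin.Subset using (Subset; _∈_; _∉_; _∪_; ⁅_⁆; ∣_∣; inside; outside)
open import Data.Fin.Subset.Properties
  using (_∈?_; p⊆p∪q; q⊆p∪q; x∈p∪q⁻; x∈⁅x⁆; x∈⁅y⁆⇒x≡y)
open import Data.Sum using ([_,_]′)
open import Data.Vec using ([]; _∷_; count; tabulate)
open import Function using (_∘_)
open import Relation.Binary.PropositionalEquality
  using (_≡_; _≢_; refl; sym; trans; cong; cong₂; subst₂)
open import Relation.Nullary using (Dec; does; yes; no; ¬_; contradiction)
open import Relation.Nullary.Decidable using (_×-dec_)
open import Relation.Unary using (Pred; Decidable)
open import Algebra.Properties.Semiring.Sum +-*-semiring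
  using (sum; sum-syntax; sum-cong-≗; ∑-distrib-+; ∑-comm; *-distribˡ-sum; *-distribʳ-sum)
open import Defs

-- Indicators and finite sums.

𝟙 : ∀ {p} {P : Set p} → Dec P → ℕ
𝟙 P? = if does P? then 1 else 0

𝟙-yes : ∀ {p} {P : Set p} (P? : Dec P) → P → 𝟙 P? ≡ 1
𝟙-yes (yes _) _ = refl
𝟙-yes (no ¬p) p = contradiction p ¬p

𝟙-no : ∀ {p} {P : Set p} (P? : Dec P) → ¬ P → 𝟙 P? ≡ 0
𝟙-no (yes p) ¬p = contradiction p ¬p
𝟙-no (no _)  _  = refl

𝟙-idem : ∀ {p} {P : Set p} (P? : Dec P) → 𝟙 P? * 𝟙 P? ≡ 𝟙 P?
𝟙-idem (yes _) = refl
𝟙-idem (no _)  = refl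

𝟙-× : ∀ {p q} {P : Set p} {Q : Set q} (P? : Dec P) (Q? : Dec Q) →
      𝟙 (P? ×-dec Q?) ≡ 𝟙 P? * 𝟙 Q?
𝟙-× (yes _) (yes _) = refl
𝟙-× (yes _) (no _)  = refl
𝟙-× (no _)  _       = refl

count-tabulate : ∀ {A : Set} {p} {P : Pred A p} (P? : Decidable P) n (f : Fin n → A) →
                 count P? (tabulate f) ≡ ∑[ i < n ] 𝟙 (P? (f i))
count-tabulate P? zero    f = refl
count-tabulate P? (suc n) f with does (P? (f zero))
... | true  = cong suc (count-tabulate P? n (f ∘ suc))
... | false = count-tabulate P? n (f ∘ suc)

∣p∣≡∑𝟙 : ∀ {n} (p : Subset n) → ∣ p ∣ ≡ ∑[ x < n ] 𝟙 (x ∈? p)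
∣p∣≡∑𝟙 []            = refl
∣p∣≡∑𝟙 (inside  ∷ p) = cong suc (∣p∣≡∑𝟙 p)
∣p∣≡∑𝟙 (outside ∷ p) = ∣p∣≡∑𝟙 p

∑-mono-≤ : ∀ {n} {f g : Fin n → ℕ} → (∀ i → f i ≤ g i) → sum f ≤ sum g
∑-mono-≤ {zero}  f≤g = z≤n
∑-mono-≤ {suc n} f≤g = +-mono-≤ (f≤g zero) (∑-mono-≤ (f≤g ∘ suc))

∑-const : ∀ n c → ∑[ i < n ] c ≡ n * c
∑-const zero    c = refl
∑-const (suc n) c = cong (_+_ c) (∑-const n c)

∑-zero : ∀ {n} {f : Fin n → ℕ} → (∀ i → f i ≡ 0) → sum f ≡ 0
∑-zero {n} f≡0 = trans (sum-cong-≗ {n} f≡0) (trans (∑-const n 0) (*-zeroʳ n))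

∑-δ : ∀ {n} (x : Fin n) (f : Fin n → ℕ) → ∑[ y < n ] (𝟙 (x Fin.≟ y) * f y) ≡ f x
∑-δ {suc n} zero f = trans (cong₂ _+_ (+-identityʳ (f zero)) (∑-zero {n} {λ _ → 0} λ _ → refl)) (+-identityʳ (f zero))
∑-δ (suc x) f = ∑-δ x (f ∘ suc)

-- Double sums and pair counts.

∑∑ : ∀ {m n} → (Fin m → Fin n → ℕ) → ℕ
∑∑ {m} {n} f = ∑[ x < m ] ∑[ y < n ] f x y

∑∑-cong : ∀ {m n} {f g : Fin m → Fin n → ℕ} → (∀ x y → f x y ≡ g x y) → ∑∑ f ≡ ∑∑ g
∑∑-cong f≡g = sum-cong-≗ λ x → sum-cong-≗ (f≡g x)

∑∑-mono-≤ : ∀ {m n} {f g : Fin m → Fin n → ℕ} → (∀ x y → f x y ≤ g x y) → ∑∑ f ≤ ∑∑ g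
∑∑-mono-≤ f≤g = ∑-mono-≤ λ x → ∑-mono-≤ (f≤g x)

∑∑-+ : ∀ {m n} (f g : Fin m → Fin n → ℕ) → ∑∑ (λ x y → f x y + g x y) ≡ ∑∑ f + ∑∑ g
∑∑-+ f g = trans (sum-cong-≗ λ x → ∑-distrib-+ (f x) (g x)) (∑-distrib-+ (sum ∘ f) (sum ∘ g))

∑∑-*ˡ : ∀ {m n} c (f : Fin m → Fin n → ℕ) → ∑∑ (λ x y → c * f x y) ≡ c * ∑∑ f
∑∑-*ˡ c f = sym (trans (*-distribˡ-sum c (sum ∘ f)) (sum-cong-≗ λ x → *-distribˡ-sum c (f x)))

∑∑-× : ∀ {m n} (f : Fin m → ℕ) (g : Fin n → ℕ) → ∑∑ (λ x y → f x * g y) ≡ sum f * sum g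
∑∑-× f g = sym (trans (*-distribʳ-sum (sum g) f) (sum-cong-≗ λ x → *-distribˡ-sum (f x) g))

∑∑-δ : ∀ {n} (f : Fin n → Fin n → ℕ) → ∑∑ (λ x y → 𝟙 (x Fin.≟ y) * f x y) ≡ ∑[ x < n ] f x x
∑∑-δ f = sum-cong-≗ λ x → ∑-δ x (f x)

∑∑-∑-comm : ∀ {m n b} (f : Fin b → Fin m → Fin n → ℕ) →
            ∑∑ (λ x y → ∑[ i < b ] f i x y) ≡ ∑[ i < b ] ∑∑ (f i)
∑∑-∑-comm {m} {n} {b} f =
  trans (sum-cong-≗ λ x → ∑-comm (λ y i → f i x y)) (∑-comm (λ x i → ∑[ y < n ] f i x y))

pairCount≡∑ : ∀ {n b} (𝒜 : Blocks n b) x y →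
              pairCount 𝒜 x y ≡ ∑[ i < b ] (𝟙 (x ∈? 𝒜 i) * 𝟙 (y ∈? 𝒜 i))
pairCount≡∑ {b = b} 𝒜 x y =
  trans (count-tabulate (λ i → (x ∈? 𝒜 i) ×-dec (y ∈? 𝒜 i)) b (λ i → i))
        (sum-cong-≗ λ i → 𝟙-× (x ∈? 𝒜 i) (y ∈? 𝒜 i))

-- Pairs inside the blocks of the BIBD.

module _ {v k lam n b} {X : Subset n} {𝒜 : Blocks n b} (bibd : IsBIBD v k lam X 𝒜) where
  open IsDesign bibd

  private
    𝟙X : Fin n → ℕ
    𝟙X x = 𝟙 (x ∈? X)

    δ : Fin n → Fin n → ℕ
    δ x y = 𝟙 (x Fin.≟ y)

    a : Fin b → Fin n → ℕ
    a i x = 𝟙 (x ∈? 𝒜 i)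

    a-outside : ∀ i {x} → x ∉ X → a i x ≡ 0
    a-outside i {x} x∉X = 𝟙-no (x ∈? 𝒜 i) (x∉X ∘ block⊆ i)

    ∑a : ∀ i → ∑[ x < n ] a i x ≡ k
    ∑a i = trans (sym (∣p∣≡∑𝟙 (𝒜 i))) (blockSize i)

    ∑𝟙X : sum 𝟙X ≡ v
    ∑𝟙X = trans (sym (∣p∣≡∑𝟙 X)) points

    -- `δX` indicates the diagonal of X and `XX` the square X × X; `XX` minus `δX` indicates the
    -- ordered pairs of distinct points of X.
    δX : Fin n → Fin n → ℕ
    δX x y = δ x y * 𝟙X x

    XX : Fin n → Fin n → ℕ
    XX x y = 𝟙X x * 𝟙X y

    ∑∑δX : ∑∑ δX ≡ v
    ∑∑δX = trans (∑∑-δ (λ x _ → 𝟙X x)) ∑𝟙X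

    ∑∑XX : ∑∑ XX ≡ v * v
    ∑∑XX = trans (∑∑-× 𝟙X 𝟙X) (cong₂ _*_ ∑𝟙X ∑𝟙X)

    -- The diagonal is included: `c x x` is the number of blocks through `x`.
    c : Fin n → Fin n → ℕ
    c x y = ∑[ i < b ] (a i x * a i y)

    c-inside : ∀ {x y} → x ∈ X → y ∈ X → x ≢ y → c x y ≡ lam
    c-inside x∈X y∈X x≢y = trans (sym (pairCount≡∑ 𝒜 _ _)) (pairs x∈X y∈X x≢y)

    -- Off the diagonal `c` is `lam` on X × X and 0 elsewhere, since blocks lie in X. On the
    -- diagonal `δX` and `XX` agree. The term `lam * δX x y` replaces a subtraction on the right.
    c-split : ∀ x y → c x y + lam * δX x y ≡ lam * XX x y + δ x y * c x y
    c-split x y with x Fin.≟ y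
    ... | yes refl = trans (cong (λ t → c x x + lam * t) (trans (+-identityʳ _) (sym (𝟙-idem (x ∈? X)))))
                       (trans (+-comm (c x x) _) (cong (λ t → lam * (𝟙X x * 𝟙X x) + t) (sym (+-identityʳ (c x x)))))
    ... | no x≢y with x ∈? X | y ∈? X
    ...   | yes x∈X | yes y∈X rewrite c-inside x∈X y∈X x≢y = trans (cong (_+_ lam) (*-zeroʳ lam)) (cong (λ t → t + 0) (sym (*-identityʳ lam)))
    ...   | yes _   | no y∉X  = trans
      (cong (λ t → t + lam * 0) (∑-zero {b} {λ i → a i x * a i y} λ i → trans (cong (a i x *_) (a-outside i y∉X)) (*-zeroʳ (a i x))))
      (sym (+-identityʳ (lam * 0)))
    ...   | no x∉X  | _       = trans
      (cong (λ t → t + lam * 0) (∑-zero {b} {λ i → a i x * a i y} λ i → cong (_* a i y) (a-outside i x∉X)))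
      (sym (+-identityʳ (lam * 0)))

  -- bk(k − 1) = λv(v − 1), with the subtractions moved across.
  block-pairs-count : b * (k * k) + lam * v ≡ lam * (v * v) + b * k
  block-pairs-count = trans (sym lhs) (trans (∑∑-cong c-split) rhs)
    where
    -- Each block contributes its `k * k` ordered pairs, equal pairs included.
    ∑∑c : ∑∑ c ≡ b * (k * k)
    ∑∑c = trans (∑∑-∑-comm λ i x y → a i x * a i y)
            (trans (sum-cong-≗ λ i → trans (∑∑-× (a i) (a i)) (cong₂ _*_ (∑a i) (∑a i))) (∑-const b (k * k)))

    lhs : ∑∑ (λ x y → c x y + lam * δX x y) ≡ b * (k * k) + lam * v
    lhs = trans (∑∑-+ c (λ x y → lam * δX x y))
            (cong₂ _+_ ∑∑c (trans (∑∑-*ˡ lam δX) (cong (lam *_) ∑∑δX)))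

    ∑c-diagonal : ∑[ x < n ] c x x ≡ b * k
    ∑c-diagonal = trans (∑-comm λ x i → a i x * a i x)
      (trans (sum-cong-≗ λ i → trans (sum-cong-≗ λ x → 𝟙-idem (x ∈? 𝒜 i)) (∑a i)) (∑-const b k))

    rhs : ∑∑ (λ x y → lam * XX x y + δ x y * c x y) ≡ lam * (v * v) + b * k
    rhs = trans (∑∑-+ (λ x y → lam * XX x y) (λ x y → δ x y * c x y))
            (cong₂ _+_ (trans (∑∑-*ˡ lam XX) (cong (lam *_) ∑∑XX)) (trans (∑∑-δ c) ∑c-diagonal))

  -- Pairs covered by the augmented blocks.

  module _ {w} {Y : Subset n} {φ : Fin b → Fin n} (nesting : IsWeakNesting w k lam X Y 𝒜 φ) where
    open IsWeakNesting nesting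
    private
      module Augmented = IsDesign partialBIBD

      𝟙Y : Fin n → ℕ
      𝟙Y y = 𝟙 (y ∈? Y)

      ∑𝟙Y : sum 𝟙Y ≡ w
      ∑𝟙Y = trans (sym (∣p∣≡∑𝟙 Y)) Augmented.points

      f : Fin b → Fin n → ℕ
      f i y = δ (φ i) y

      f-outside : ∀ i {y} → y ∉ Y → f i y ≡ 0
      f-outside i {y} y∉Y = 𝟙-no (φ i Fin.≟ y) λ { refl → y∉Y (φ∈Y i) }

      ∑f : ∀ i → ∑[ y < n ] f i y ≡ 1
      ∑f i = trans (sum-cong-≗ λ y → sym (*-identityʳ (f i y))) (∑-δ (φ i) (λ _ → 1))

      e : Fin n → Fin n → ℕ
      e x y = ∑[ i < b ] (a i x * f i y)

      e-outsideˡ : ∀ {x} y → x ∉ X → e x y ≡ 0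
      e-outsideˡ {x} y x∉X = ∑-zero {b} {λ i → a i x * f i y} λ i → cong (_* f i y) (a-outside i x∉X)

      e-outsideʳ : ∀ x {y} → y ∉ Y → e x y ≡ 0
      e-outsideʳ x {y} y∉Y = ∑-zero {b} {λ i → a i x * f i y} λ i → trans (cong (a i x *_) (f-outside i y∉Y)) (*-zeroʳ (a i x))

      e-diagonal : ∀ x → e x x ≡ 0
      e-diagonal x = ∑-zero af≡0
        where
        af≡0 : ∀ i → a i x * f i x ≡ 0
        af≡0 i with φ i Fin.≟ x
        ... | yes refl = cong (_* 1) (𝟙-no (x ∈? 𝒜 i) (φ∉block i))
        ... | no _     = *-zeroʳ (a i x)

      -- The indicators add because the union is disjoint: `φ i` lies outside `𝒜 i`.
      𝟙-augmented : ∀ i x → 𝟙 (x ∈? 𝒜 i ∪ ⁅ φ i ⁆) ≡ a i x + f i x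
      𝟙-augmented i x with x ∈? 𝒜 i | φ i Fin.≟ x
      ... | yes x∈A | yes refl = contradiction x∈A (φ∉block i)
      ... | yes x∈A | no _     = 𝟙-yes (x ∈? _) (p⊆p∪q ⁅ φ i ⁆ x∈A)
      ... | no _    | yes refl = 𝟙-yes (x ∈? _) (q⊆p∪q (𝒜 i) ⁅ x ⁆ (x∈⁅x⁆ x))
      ... | no x∉A  | no φ≢x   = 𝟙-no (x ∈? _)
              ([ x∉A , (λ x∈⁅φ⁆ → φ≢x (sym (x∈⁅y⁆⇒x≡y (φ i) x∈⁅φ⁆))) ]′ ∘ x∈p∪q⁻ (𝒜 i) ⁅ φ i ⁆)

      c+e+e≤1+λ : ∀ {x y} → x ∈ Y → y ∈ Y → x ≢ y → c x y + (e x y + e y x) ≤ suc lam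
      c+e+e≤1+λ {x} {y} x∈Y y∈Y x≢y = begin
        c x y + (e x y + e y x)
          ≡⟨ cong (_+_ (c x y)) (∑-distrib-+ (λ i → a i x * f i y) (λ i → a i y * f i x)) ⟨
        c x y + ∑[ i < b ] (a i x * f i y + a i y * f i x)
          ≡⟨ ∑-distrib-+ (λ i → a i x * a i y) (λ i → a i x * f i y + a i y * f i x) ⟨
        ∑[ i < b ] (a i x * a i y + (a i x * f i y + a i y * f i x))
          -- The expanded product has one further term, `f i x * f i y`, which is nonnegative and is
          -- dropped.
          ≤⟨ ∑-mono-≤ (λ i → product-bound (a i x) (a i y) (f i x) (f i y)) ⟩
        ∑[ i < b ] ((a i x + f i x) * (a i y + f i y))
          ≡⟨ sum-cong-≗ (λ i → cong₂ _*_ (𝟙-augmented i x) (𝟙-augmented i y)) ⟨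
        ∑[ i < b ] (𝟙 (x ∈? 𝒜 i ∪ ⁅ φ i ⁆) * 𝟙 (y ∈? 𝒜 i ∪ ⁅ φ i ⁆))
          ≡⟨ pairCount≡∑ (λ i → 𝒜 i ∪ ⁅ φ i ⁆) x y ⟨
        pairCount (λ i → 𝒜 i ∪ ⁅ φ i ⁆) x y
          ≤⟨ Augmented.pairs x∈Y y∈Y x≢y ⟩
        suc lam ∎
        where
        open ≤-Reasoning
        expand : ∀ p q r s → p * q + (p * s + q * r) + r * s ≡ (p + r) * (q + s)
        expand = solve-∀
        product-bound : ∀ p q r s → p * q + (p * s + q * r) ≤ (p + r) * (q + s)
        product-bound p q r s = ≤-trans (m≤m+n _ (r * s)) (≤-reflexive (expand p q r s))

      -- The original blocks already cover the pair `lam` times, so the nesting can cover it at most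
      -- once more.
      e+e≤1 : ∀ {x y} → x ∈ X → y ∈ X → x ≢ y → e x y + e y x ≤ 1
      e+e≤1 {x} {y} x∈X y∈X x≢y = +-cancelˡ-≤ lam _ 1 (begin
        lam + (e x y + e y x)    ≡⟨ cong (_+ (e x y + e y x)) (c-inside x∈X y∈X x≢y) ⟨
        c x y + (e x y + e y x)  ≤⟨ c+e+e≤1+λ (X⊆Y x∈X) (X⊆Y y∈X) x≢y ⟩
        suc lam                  ≡⟨ +-comm 1 lam ⟩
        lam + 1                  ∎)
        where open ≤-Reasoning

      -- For `y` in Y this is the pair bound with `c` dropped. For `y` outside Y both terms vanish:
      -- φ takes values in Y, and no block passes through `y`.
      e+e≤[1+λ]𝟙Y : ∀ {x y} → x ∈ X → y ∉ X → e x y + e y x ≤ suc lam * 𝟙Y y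
      e+e≤[1+λ]𝟙Y {x} {y} x∈X y∉X with y ∈? Y
      ... | yes y∈Y = ≤-trans (m≤n+m (e x y + e y x) (c x y))
                        (≤-trans (c+e+e≤1+λ (X⊆Y x∈X) y∈Y λ { refl → y∉X x∈X })
                                 (≤-reflexive (sym (*-identityʳ (suc lam)))))
      ... | no y∉Y  = ≤-trans (≤-reflexive (cong₂ _+_ (e-outsideʳ x y∉Y) (e-outsideˡ x y∉X))) z≤n

      XY : Fin n → Fin n → ℕ
      XY x y = 𝟙X x * 𝟙Y y

      ∑∑XY : ∑∑ XY ≡ v * w
      ∑∑XY = trans (∑∑-× 𝟙X 𝟙Y) (cong₂ _*_ ∑𝟙X ∑𝟙Y)

      -- One inequality for all ordered pairs, ready to be summed. Since X ⊆ Y, `XY x y + XY y x`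
      -- minus `2 * XX x y` indicates that one point lies in X and the other in Y outside X; the
      -- subtracted terms stand on the left.
      e-bound : ∀ x y →
        (e x y + e y x) + (δX x y + 2 * suc lam * XX x y) ≤
        XX x y + suc lam * (XY x y + XY y x)
      e-bound x y with x ∈? X | y ∈? X
      ... | no x∉X  | no y∉X  rewrite e-outsideˡ y x∉X | e-outsideˡ x y∉X
                                    | *-zeroʳ (δ x y) | *-zeroʳ (2 * suc lam) = z≤n
      ... | yes x∈X | no y∉X  rewrite 𝟙-no (x Fin.≟ y) (λ { refl → y∉X x∈X }) | *-zeroʳ (2 * suc lam)
                                    | +-identityʳ (e x y + e y x)
                                    | +-identityʳ (𝟙Y y) | +-identityʳ (𝟙Y y) = e+e≤[1+λ]𝟙Y x∈X y∉X
      ... | no x∉X  | yes y∈X rewrite *-zeroʳ (δ x y) | *-zeroʳ (2 * suc lam) | +-identityʳ (𝟙Y x)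
                                    | +-identityʳ (e x y + e y x) | +-comm (e x y) (e y x) = e+e≤[1+λ]𝟙Y y∈X x∉X
      -- Both points also lie in Y, so the right side is the constant `1 + suc lam * 2`.
      ... | yes x∈X | yes y∈X rewrite 𝟙-yes (x ∈? Y) (X⊆Y x∈X) | 𝟙-yes (y ∈? Y) (X⊆Y y∈X) = begin
        e x y + e y x + (δ x y * 1 + 2 * suc lam * 1)  ≡⟨ solve-lhs (e x y + e y x) (δ x y) lam ⟩
        (e x y + e y x + δ x y) + suc lam * 2          ≤⟨ +-monoˡ-≤ (suc lam * 2) both-inside ⟩
        1 + suc lam * 2                                ∎
        where
        open ≤-Reasoning
        solve-lhs : ∀ p d l → p + (d * 1 + 2 * suc l * 1) ≡ (p + d) + suc l * 2
        solve-lhs = solve-∀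
        both-inside : e x y + e y x + δ x y ≤ 1
        both-inside with x Fin.≟ y
        ... | yes refl = ≤-reflexive (cong (_+ 1) (cong₂ _+_ (e-diagonal x) (e-diagonal x)))
        ... | no x≢y   = ≤-trans (≤-reflexive (+-identityʳ _)) (e+e≤1 x∈X y∈X x≢y)

    -- 2bk ≤ v(v − 1) + 2(λ + 1)v(w − v), with the subtractions moved across.
    flag-count-bound : b * k + b * k + (v + 2 * suc lam * (v * v)) ≤ v * v + suc lam * (v * w + v * w)
    flag-count-bound = begin
      b * k + b * k + (v + 2 * suc lam * (v * v))
        ≡⟨ lhs ⟨
      ∑∑ (λ x y → (e x y + e y x) + (δX x y + 2 * suc lam * XX x y))
        ≤⟨ ∑∑-mono-≤ e-bound ⟩
      ∑∑ (λ x y → XX x y + suc lam * (XY x y + XY y x))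
        ≡⟨ rhs ⟩
      v * v + suc lam * (v * w + v * w) ∎
      where
      open ≤-Reasoning
      ∑∑-sym : ∀ (g : Fin n → Fin n → ℕ) → ∑∑ (λ x y → g x y + g y x) ≡ ∑∑ g + ∑∑ g
      ∑∑-sym g = trans (∑∑-+ g (λ x y → g y x)) (cong (_+_ (∑∑ g)) (∑-comm (λ x y → g y x)))

      -- Each block contributes its `k` points, each paired with the single image under φ.
      ∑∑e : ∑∑ e ≡ b * k
      ∑∑e = trans (∑∑-∑-comm λ i x y → a i x * f i y)
        (trans (sum-cong-≗ λ i → trans (∑∑-× (a i) (f i)) (trans (cong₂ _*_ (∑a i) (∑f i)) (*-identityʳ k)))
               (∑-const b k))

      lhs : ∑∑ (λ x y → (e x y + e y x) + (δX x y + 2 * suc lam * XX x y)) ≡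
            b * k + b * k + (v + 2 * suc lam * (v * v))
      lhs = trans (∑∑-+ (λ x y → e x y + e y x) (λ x y → δX x y + 2 * suc lam * XX x y)) (cong₂ _+_
        (trans (∑∑-sym e) (cong₂ _+_ ∑∑e ∑∑e))
        (trans (∑∑-+ δX (λ x y → 2 * suc lam * XX x y))
          (cong₂ _+_ ∑∑δX (trans (∑∑-*ˡ (2 * suc lam) XX) (cong (2 * suc lam *_) ∑∑XX)))))

      rhs : ∑∑ (λ x y → XX x y + suc lam * (XY x y + XY y x)) ≡ v * v + suc lam * (v * w + v * w)
      rhs = trans (∑∑-+ XX (λ x y → suc lam * (XY x y + XY y x))) (cong₂ _+_ ∑∑XX
        (trans (∑∑-*ˡ (suc lam) (λ x y → XY x y + XY y x))
          (cong (suc lam *_) (trans (∑∑-sym XY) (cong₂ _+_ ∑∑XY ∑∑XY)))))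

-- Elimination of b and clearing of denominators.

-- Here v = v′ + 1 and k = K + 1, so that r = λv′/K.
eliminate-b : ∀ v′ K lam w b → let v = suc v′ ; k = suc K in
  b * (k * k) + lam * v ≡ lam * (v * v) + b * k →
  b * k + b * k + (v + 2 * suc lam * (v * v)) ≤ v * v + suc lam * (v * w + v * w) →
  2 * (lam * v′) + K * (v + 2 * lam * v + 1) ≤ 2 * (K * suc lam * w)
eliminate-b v′ K lam w b pairs-eq flags-≤ =
  -- Adding Kv to both sides and multiplying by v turns the goal into K times the flag bound, with
  -- bkK replaced by λv(v - 1).
  +-cancelʳ-≤ (K * suc v′) _ _ (*-cancelˡ-≤ (suc v′) (begin
    suc v′ * (2 * (lam * v′) + K * (suc v′ + 2 * lam * suc v′ + 1) + K * suc v′)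
      ≡⟨ expand-lhs v′ K lam ⟩
    lam * (v′ * suc v′) + lam * (v′ * suc v′) + K * (suc v′ + 2 * suc lam * (suc v′ * suc v′))
      ≡⟨ cong (λ t → t + t + K * (suc v′ + 2 * suc lam * (suc v′ * suc v′))) bkK ⟨
    b * suc K * K + b * suc K * K + K * (suc v′ + 2 * suc lam * (suc v′ * suc v′))
      ≡⟨ factor-K K (b * suc K) (suc v′ + 2 * suc lam * (suc v′ * suc v′)) ⟩
    K * (b * suc K + b * suc K + (suc v′ + 2 * suc lam * (suc v′ * suc v′)))
      ≤⟨ *-monoʳ-≤ K flags-≤ ⟩
    K * (suc v′ * suc v′ + suc lam * (suc v′ * w + suc v′ * w))
      ≡⟨ expand-rhs v′ K lam w ⟩
    suc v′ * (2 * (K * suc lam * w) + K * suc v′) ∎))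
  where
  open ≤-Reasoning
  split-lhs : ∀ b K l v′ → b * suc K * K + (l * suc v′ + b * suc K) ≡ b * (suc K * suc K) + l * suc v′
  split-lhs = solve-∀
  split-rhs : ∀ b K l v′ → l * (suc v′ * suc v′) + b * suc K ≡ l * (v′ * suc v′) + (l * suc v′ + b * suc K)
  split-rhs = solve-∀
  -- The common summand λv + bk is cancelled from both sides of `pairs-eq`.
  bkK : b * suc K * K ≡ lam * (v′ * suc v′)
  bkK = +-cancelʳ-≡ (lam * suc v′ + b * suc K) _ _
          (trans (split-lhs b K lam v′) (trans pairs-eq (split-rhs b K lam v′)))
  expand-lhs : ∀ v′ K l → suc v′ * (2 * (l * v′) + K * (suc v′ + 2 * l * suc v′ + 1) + K * suc v′) ≡
    l * (v′ * suc v′) + l * (v′ * suc v′) + K * (suc v′ + 2 * suc l * (suc v′ * suc v′))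
  expand-lhs = solve-∀
  factor-K : ∀ K R s → R * K + R * K + K * s ≡ K * (R + R + s)
  factor-K = solve-∀
  expand-rhs : ∀ v′ K l w → K * (suc v′ * suc v′ + suc l * (suc v′ * w + suc v′ * w)) ≡
    suc v′ * (2 * (K * suc l * w) + K * suc v′)
  expand-rhs = solve-∀

-- The left side is what the order on unnormalised rationals unfolds to: the first `+ 1` is the
-- numerator of 1/(λ + 1), the last one the denominator of w/1.
pos-numerator : ∀ l m D N E →
  ((+ l ℤ.* + m) ℤ.* (+ 1) ℤ.* (+ D) ℤ.+ (+ N) ℤ.* (+ E)) ℤ.* (+ 1) ≡ + (l * m * D + N * E)
pos-numerator l m D N E = trans (ℤₚ.*-identityʳ _) (cong₂ ℤ._+_
  (trans (cong (ℤ._* (+ D)) (trans (ℤₚ.*-identityʳ _) (sym (ℤₚ.pos-* l m)))) (sym (ℤₚ.pos-* (l * m) D)))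
  (sym (ℤₚ.pos-* N E)))

theorem3p1 : (v k lam w n b : ℕ) → 1 ≤ v → (2≤k : 2 ≤ k) →
    (X Y : Subset n) (𝒜 : Blocks n b) (φ : Fin b → Fin n) →
    IsBIBD v k lam X 𝒜 →
    IsWeakNesting w k lam X Y 𝒜 φ →
    (+ w / 1) ℚᵘ.≥ (replication v k lam 2≤k ÷ (+ suc lam / 1)) ℚᵘ.+ (+ (v + 2 * lam * v + 1) / (2 * suc lam))
theorem3p1 v (suc zero) lam w n b 1≤v (s≤s ()) X Y 𝒜 φ bibd nesting
-- With these patterns v - 1 and k - 1 compute to `v′` and `suc K′`.
theorem3p1 (suc v′) (suc (suc K′)) lam w n b 1≤v 2≤k X Y 𝒜 φ bibd nesting =
  ℚᵘ.*≤* (subst₂ ℤ._≤_ (sym (pos-numerator lam v′ D N E)) (ℤₚ.pos-* w (E * D)) (ℤ.+≤+ cleared))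
  where
  open ≤-Reasoning
  -- `E` is the denominator of r/(λ + 1); `N` and `D` are the numerator and denominator of the
  -- second summand.
  D N E : ℕ
  D = 2 * suc lam
  N = suc v′ + 2 * lam * suc v′ + 1
  E = suc K′ * suc lam

  factor-lhs : ∀ r l N K → r * (2 * suc l) + N * (K * suc l) ≡ suc l * (2 * r + K * N)
  factor-lhs = solve-∀
  factor-rhs : ∀ l w K → suc l * (2 * (K * suc l * w)) ≡ w * (K * suc l * (2 * suc l))
  factor-rhs = solve-∀

  -- Both `D` and `E` contain the factor λ + 1, so this is λ + 1 times the inequality of
  -- `eliminate-b`.
  cleared : lam * v′ * D + N * E ≤ w * (E * D)
  cleared = begin
    lam * v′ * D + N * E                       ≡⟨ factor-lhs (lam * v′) lam N (suc K′) ⟩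
    suc lam * (2 * (lam * v′) + suc K′ * N)    ≤⟨ *-monoʳ-≤ (suc lam) (eliminate-b v′ (suc K′) lam w b
                                                    (block-pairs-count bibd) (flag-count-bound bibd nesting)) ⟩
    suc lam * (2 * (suc K′ * suc lam * w))     ≡⟨ factor-rhs lam w (suc K′) ⟩
    w * (E * D)                                ∎
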